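{- Let $G=(V,E)$ be a finite graph. For a partition of $E$ into three sets $X,Y,Z$ (not all of which need be non-empty), choose $A\subseteq X$, $B\subseteq Y$ and $C\subseteq Z$ independently and uniformly at random, let $\Sigma$ be the event that $|A|+|B|+|C|\equiv 0\pmod 2$, and let $\Gamma$ be the event that $A\cup C$ and $C\cup B$ are both eulerian. Then $\mathrm{Bias}(\Sigma\mid\Gamma)\neq 0$ for some such tripartition $\{X,Y,Z\}$ of $E$ if and only if $P(G;4)\neq 0$.
   Context: Graphs are finite; loops and parallel edges are permitted. A subset $A\subseteq E$ is identified with the subgraph $(V,A)$ of $G$; it is called eulerian if all its vertex degrees are even (a loop contributes 2 to the degree). $P(G;q)$ is the number of proper vertex $q$-colourings of $G$. $\mathrm{Bias}(\Sigma\mid\Gamma)=\mathbb{P}(\Sigma\mid\Gamma)-\mathbb{P}(\overline{\Sigma}\mid\Gamma)$, where $\overline{\Sigma}$ is the complement of $\Sigma$. -}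

module Defs where

open import Data.Bool using (if_then_else_)
open import Data.Fin using (Fin)
import Data.Fin as Fin
open import Data.Fin.Properties using (all?)
open import Data.Fin.Subset
  using (Subset; inside; outside; _⊆_; _∪_; _∩_; ⊥; ⊤; ∣_∣)
open import Data.Fin.Subset.Properties using (_∈?_; _⊆?_; ⊥⊆; ∉⊥; ∪-identityʳ)
import Data.Integer as ℤ
open import Data.List
  using (List; []; _∷_; [_]; length; map; filter; allFin;
         cartesianProduct; cartesianProductWith)
open import Data.List.Properties using (filter-none)
import Data.List.Membership.Propositional as List
open import Data.List.Membership.Propositional.Properties
  using (∈-cartesianProduct⁺; ∈-cartesianProductWith⁺; ∈-filter⁺; ∈-length)
open import Data.List.Relation.Unary.All using (universal)
open import Data.List.Relation.Unary.Any using (here)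
open import Data.Nat using (ℕ; zero; suc; _+_; NonZero; >-nonZero)
open import Data.Nat.Divisibility using (_∣_; _∣?_; _∣0)
open import Data.Nat.ListAction using (sum)
open import Data.Product using (_×_; _,_; proj₁; proj₂)
import Data.Rational as ℚ
open import Data.Rational using (ℚ; _÷_; _-_)
open import Data.Rational.Properties using (normalize-pos; pos⇒nonZero)
open import Data.Vec using (Vec; []; _∷_; lookup)
open import Level using (Level)
open import Relation.Binary.PropositionalEquality using (_≡_; _≢_; refl; sym; cong; subst)
open import Relation.Nullary.Decidable using (does; ¬?; _×-dec_)
open import Relation.Unary using (Pred; Decidable)
open import Relation.Unary.Properties using (∁?; _∩?_)

private
  variable
    a s t : Level
    A : Set a
    m : ℕ

-- The order of the two ends of an edge carries no information: every notion
-- below is symmetric in them.  A loop is an edge with equal ends, and distinct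
-- edges may have the same ends.
record Graph : Set where
  field
    #V   : ℕ
    #E   : ℕ
    ends : Fin #E → Fin #V × Fin #V

open Graph public

vecs : List A → (n : ℕ) → List (Vec A n)
vecs xs zero    = [ [] ]
vecs xs (suc n) = cartesianProductWith _∷_ xs (vecs xs n)

module _ (G : Graph) where

  -- 0, 1 or 2; a loop at v counts twice.
  incidence : Fin (#V G) → Fin (#E G) → ℕ
  incidence v e = δ (proj₁ (ends G e)) + δ (proj₂ (ends G e))
    where
    δ : Fin (#V G) → ℕ
    δ u = if does (u Fin.≟ v) then 1 else 0

  degree : Subset (#E G) → Fin (#V G) → ℕ
  degree A v = sum (map (incidence v) (filter (_∈? A) (allFin (#E G))))

  Eulerian : Subset (#E G) → Set
  Eulerian A = ∀ v → 2 ∣ degree A v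

  eulerian? : Decidable Eulerian
  eulerian? A = all? λ v → 2 ∣? degree A v

  Proper : ∀ {q} → Vec (Fin q) (#V G) → Set
  Proper κ = ∀ e → lookup κ (proj₁ (ends G e)) ≢ lookup κ (proj₂ (ends G e))

  proper? : ∀ {q} → Decidable (Proper {q})
  proper? κ = all? λ e → ¬? (lookup κ (proj₁ (ends G e)) Fin.≟ lookup κ (proj₂ (ends G e)))

  P : ℕ → ℕ
  P q = length (filter proper? (vecs (allFin q) (#V G)))

record IsTripartition (X Y Z : Subset m) : Set where
  field
    X∪Y∪Z≡⊤ : X ∪ Y ∪ Z ≡ ⊤
    X∩Y≡⊥   : X ∩ Y ≡ ⊥
    X∩Z≡⊥   : X ∩ Z ≡ ⊥
    Y∩Z≡⊥   : Y ∩ Z ≡ ⊥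

-- Ω lists the outcomes, without repetition in every use below, and the
-- outcomes are equally likely.
module _ (Ω : List A) .{{_ : NonZero (length Ω)}} where

  ℙ : {S : Pred A s} → Decidable S → ℚ
  ℙ S? = ℤ.+ length (filter S? Ω) ℚ./ length Ω

  ℙ[_∣_] : {S : Pred A s} {T : Pred A t} (S? : Decidable S) (T? : Decidable T)
           .{{_ : ℚ.NonZero (ℙ T?)}} → ℚ
  ℙ[ S? ∣ T? ] = ℙ (S? ∩? T?) ÷ ℙ T?

  Bias[_∣_] : {S : Pred A s} {T : Pred A t} (S? : Decidable S) (T? : Decidable T)
              .{{_ : ℚ.NonZero (ℙ T?)}} → ℚ
  Bias[ S? ∣ T? ] = ℙ[ S? ∣ T? ] - ℙ[ ∁? S? ∣ T? ]

Triple : ℕ → Set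
Triple m = Subset m × Subset m × Subset m

subsetsOf : Subset m → List (Subset m)
subsetsOf {m} X = filter (_⊆? X) (vecs (outside ∷ inside ∷ []) m)

-- The uniform distribution on this product makes its three components
-- independent and uniform.
triples : (X Y Z : Subset m) → List (Triple m)
triples X Y Z = cartesianProduct (subsetsOf X) (cartesianProduct (subsetsOf Y) (subsetsOf Z))

EvenTotal : Triple m → Set
EvenTotal (A , B , C) = 2 ∣ ∣ A ∣ + ∣ B ∣ + ∣ C ∣

evenTotal? : Decidable (EvenTotal {m})
evenTotal? (A , B , C) = 2 ∣? ∣ A ∣ + ∣ B ∣ + ∣ C ∣

module _ (G : Graph) where

  BothEulerian : Triple (#E G) → Set
  BothEulerian (A , B , C) = Eulerian G (A ∪ C) × Eulerian G (C ∪ B)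

  bothEulerian? : Decidable BothEulerian
  bothEulerian? (A , B , C) = eulerian? G (A ∪ C) ×-dec eulerian? G (C ∪ B)

-- Conditioning is legitimate: the triple (∅ , ∅ , ∅) is always an outcome, and
-- it satisfies the conditioning event.
private
  ⊥∈vecs : ∀ n → ⊥ List.∈ vecs (outside ∷ inside ∷ []) n
  ⊥∈vecs zero    = here refl
  ⊥∈vecs (suc n) = ∈-cartesianProductWith⁺ _∷_ {xs = outside ∷ inside ∷ []} (here refl) (⊥∈vecs n)

  ⊥∈subsetsOf : (X : Subset m) → ⊥ List.∈ subsetsOf X
  ⊥∈subsetsOf {m} X = ∈-filter⁺ (_⊆? X) (⊥∈vecs m) ⊥⊆

  ⊥∈triples : (X Y Z : Subset m) → (⊥ , ⊥ , ⊥) List.∈ triples X Y Z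
  ⊥∈triples X Y Z =
    ∈-cartesianProduct⁺ (⊥∈subsetsOf X) (∈-cartesianProduct⁺ (⊥∈subsetsOf Y) (⊥∈subsetsOf Z))

  eulerian-⊥ : ∀ G → Eulerian G ⊥
  eulerian-⊥ G v = subst (2 ∣_)
    (cong (λ es → sum (map (incidence G v) es))
      (sym (filter-none (_∈? ⊥) (universal (λ _ → ∉⊥) (allFin (#E G))))))
    (2 ∣0)

  eulerian-⊥∪⊥ : ∀ G → Eulerian G (⊥ ∪ ⊥)
  eulerian-⊥∪⊥ G = subst (Eulerian G) (sym (∪-identityʳ ⊥)) (eulerian-⊥ G)

triples-nonZero : (X Y Z : Subset m) → NonZero (length (triples X Y Z))
triples-nonZero X Y Z = >-nonZero (∈-length (⊥∈triples X Y Z))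

ℙ-bothEulerian-nonZero : ∀ G (X Y Z : Subset (#E G)) →
  ℚ.NonZero (ℙ (triples X Y Z) {{triples-nonZero X Y Z}} (bothEulerian? G))
ℙ-bothEulerian-nonZero G X Y Z =
  pos⇒nonZero (ℙ Ω {{Ω≢[]}} (bothEulerian? G))
    {{normalize-pos (length (filter (bothEulerian? G) Ω)) (length Ω) {{Ω≢[]}} {{count≢0}}}}
  where
  Ω : List (Triple (#E G))
  Ω = triples X Y Z

  Ω≢[] : NonZero (length Ω)
  Ω≢[] = triples-nonZero X Y Z

  count≢0 : NonZero (length (filter (bothEulerian? G) Ω))
  count≢0 = >-nonZero (∈-length
    (∈-filter⁺ (bothEulerian? G) (⊥∈triples X Y Z) (eulerian-⊥∪⊥ G , eulerian-⊥∪⊥ G)))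

bias : (G : Graph) (X Y Z : Subset (#E G)) → ℚ
bias G X Y Z =
  Bias[_∣_] (triples X Y Z) {{triples-nonZero X Y Z}} evenTotal? (bothEulerian? G)
    {{ℙ-bothEulerian-nonZero G X Y Z}}

{-# OPTIONS --safe #-}
module Submission where

-- Weight every outcome (A , B , C) satisfying the conditioning event by
-- (-1)^(|A|+|B|+|C|); the bias vanishes iff the sum D of these weights does.
-- Detecting each of the two Eulerian conditions by a sum over sign vectors on
-- V and exchanging summations gives
--
--   4^|V| D = Σ_{s,t : V → ℤ/2} Π_e w(e),
--
-- where, with δs(e) the sum of s over the ends of e, the factor w(e) is
-- 1 - (-1)^δs(e) for e in X, 1 - (-1)^δt(e) for e in Y and
-- 1 - (-1)^(δs(e)+δt(e)) for e in Z.  Each w(e) is 0 or 2, so D ≠ 0 iff some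
-- (s , t) makes every w(e) nonzero, and then (s , t) is a proper colouring by
-- ℤ/2 × ℤ/2.  Conversely, from such a colouring take for X the edges with
-- δs(e) = 1, for Y all other edges, and Z = ∅.

open import Defs
open import Algebra.Properties.CommutativeSemigroup using (interchange)
open import Algebra.Properties.Group using (x∙y⁻¹≈ε⇒x≈y)
open import Data.Bool using (Bool; true; false; if_then_else_; _∧_; _∨_; not; _xor_)
open import Data.Bool.Properties using (xor-same)
open import Data.Fin using (Fin; zero; suc)
import Data.Fin as Fin
open import Data.Fin.Patterns
open import Data.Fin.Properties using (¬∀⟶∃¬)
open import Data.Fin.Subset using (Subset; inside; outside; _∪_; _∩_; ∣_∣; ⊤; ⊥; ∁)
open import Data.Fin.Subset.Properties using (_∈?_; _⊆?_; ∪-identityʳ; ∪-inverseʳ; ∩-inverseʳ; ∩-zeroʳ)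
open import Data.Integer using (ℤ; +_; 0ℤ; 1ℤ; -1ℤ; _+_; _*_; _-_; _^_; _≤_; _<_; +≤+)
import Data.Integer as ℤ
open import Data.Integer.Properties
open import Data.List
  using (List; []; _∷_; length; map; filter; foldr; _++_; cartesianProduct; cartesianProductWith; allFin)
import Data.List as List
open import Data.List.Membership.Propositional using () renaming (_∈_ to _∈ˡ_)
open import Data.List.Membership.Propositional.Properties
  using (∈-cartesianProductWith⁺; ∈-cartesianProduct⁺; ∈-filter⁺; ∈-filter⁻; ∈-length; ∈-allFin)
open import Data.List.Relation.Unary.Any using (here; there)
open import Data.Nat using (ℕ; zero; suc; NonZero)
import Data.Nat as ℕ
import Data.Nat.Properties as ℕ
open import Data.Nat.Divisibility using (_∣?_; ∣m+n∣m⇒∣n; ∣m∣n⇒∣m+n; ∣-refl)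
open import Data.Nat.ListAction using (sum)
open import Data.Product using (_×_; _,_; proj₁; proj₂; ∃; ∃-syntax; uncurry)
open import Data.Rational using (0ℚ)
import Data.Rational as ℚ
import Data.Rational.Properties as ℚ
open import Data.Rational.Unnormalised using (mkℚᵘ; *≡*)
open import Data.Sum using ([_,_])
import Data.Vec as Vec
open import Data.Vec using (Vec; []; _∷_; lookup; tabulate)
open import Data.Vec.Properties using (lookup-map; lookup-zipWith; lookup-replicate; lookup∘tabulate)
open import Function using (_∘_; id)
open import Function.Bundles using (_⇔_; mk⇔; Equivalence)
open import Level using (Level)
open import Relation.Binary.PropositionalEquality hiding ([_])
open import Relation.Nullary using (Dec; yes; no; ¬_; does; contradiction; _→-dec_)
open import Relation.Nullary.Decidable using (does-⇔; dec-true; dec-false)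
open import Relation.Unary using (Pred; Decidable)
open import Relation.Unary.Properties using (∁?; _∩?_)
open import Algebra.Properties.CommutativeMonoid.Sum *-1-commutativeMonoid
  using () renaming (sum to ∏; sum-cong-≗ to ∏-cong; ∑-distrib-+ to ∏-distrib-*; ∑-comm to ∏-comm)

open ≡-Reasoning

private
  variable
    a b c p q : Level
    A : Set a
    B : Set b
    C : Set c
    n : ℕ

-- Integer sums over lists and integer products over finite index sets.

∑ : List A → (A → ℤ) → ℤ
∑ xs f = foldr (λ x → _+_ (f x)) 0ℤ xs

∑-cong : {f g : A → ℤ} → (∀ x → f x ≡ g x) → ∀ xs → ∑ xs f ≡ ∑ xs g
∑-cong f≗g []       = refl
∑-cong f≗g (x ∷ xs) = cong₂ _+_ (f≗g x) (∑-cong f≗g xs)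

∑-++ : ∀ xs ys (f : A → ℤ) → ∑ (xs ++ ys) f ≡ ∑ xs f + ∑ ys f
∑-++ []       ys f = sym (+-identityˡ _)
∑-++ (x ∷ xs) ys f = trans (cong (_+_ (f x)) (∑-++ xs ys f)) (sym (+-assoc (f x) (∑ xs f) (∑ ys f)))

∑-map : (h : A → B) → ∀ xs (f : B → ℤ) → ∑ (map h xs) f ≡ ∑ xs (f ∘ h)
∑-map h []       f = refl
∑-map h (x ∷ xs) f = cong (_+_ (f (h x))) (∑-map h xs f)

∑-cartesianProductWith : (h : A → B → C) → ∀ xs ys (f : C → ℤ) →
  ∑ (cartesianProductWith h xs ys) f ≡ ∑ xs λ x → ∑ ys λ y → f (h x y)
∑-cartesianProductWith h []       ys f = refl
∑-cartesianProductWith h (x ∷ xs) ys f = trans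
  (∑-++ (map (h x) ys) _ f)
  (cong₂ _+_ (∑-map (h x) ys f) (∑-cartesianProductWith h xs ys f))

∑-distrib-+ : ∀ xs (f g : A → ℤ) → ∑ xs (λ x → f x + g x) ≡ ∑ xs f + ∑ xs g
∑-distrib-+ []       f g = refl
∑-distrib-+ (x ∷ xs) f g = trans
  (cong (_+_ (f x + g x)) (∑-distrib-+ xs f g))
  (interchange +-commutativeSemigroup (f x) (g x) (∑ xs f) (∑ xs g))

∑-distribˡ-* : ∀ k xs (f : A → ℤ) → k * ∑ xs f ≡ ∑ xs λ x → k * f x
∑-distribˡ-* k []       f = *-zeroʳ k
∑-distribˡ-* k (x ∷ xs) f = trans (*-distribˡ-+ k (f x) (∑ xs f)) (cong (_+_ (k * f x)) (∑-distribˡ-* k xs f))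

∑-distribʳ-* : ∀ k xs (f : A → ℤ) → ∑ xs f * k ≡ ∑ xs λ x → f x * k
∑-distribʳ-* k xs f = trans (*-comm (∑ xs f) k)
  (trans (∑-distribˡ-* k xs f) (∑-cong (λ x → *-comm k (f x)) xs))

∑-*-∑ : ∀ xs ys (f : A → ℤ) (g : B → ℤ) →
  ∑ xs f * ∑ ys g ≡ ∑ (cartesianProduct xs ys) λ (x , y) → f x * g y
∑-*-∑ xs ys f g = begin
  ∑ xs f * ∑ ys g                                    ≡⟨ ∑-distribʳ-* _ xs f ⟩
  ∑ xs (λ x → f x * ∑ ys g)                          ≡⟨ ∑-cong (λ x → ∑-distribˡ-* (f x) ys g) xs ⟩
  ∑ xs (λ x → ∑ ys λ y → f x * g y)                  ≡⟨ ∑-cartesianProductWith _,_ xs ys (λ (x , y) → f x * g y) ⟨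
  ∑ (cartesianProduct xs ys) (λ (x , y) → f x * g y) ∎

∑-zero : ∀ (xs : List A) → ∑ xs (λ _ → 0ℤ) ≡ 0ℤ
∑-zero []       = refl
∑-zero (x ∷ xs) = trans (+-identityˡ _) (∑-zero xs)

∑-comm : ∀ xs ys (f : A → B → ℤ) →
  ∑ xs (λ x → ∑ ys (f x)) ≡ ∑ ys λ y → ∑ xs λ x → f x y
∑-comm []       ys f = sym (∑-zero ys)
∑-comm (x ∷ xs) ys f = trans (cong (_+_ (∑ ys (f x))) (∑-comm xs ys f))
  (sym (∑-distrib-+ ys (f x) λ y → ∑ xs λ x → f x y))

∑≢0⇒∃≢0 : ∀ xs (f : A → ℤ) → ∑ xs f ≢ 0ℤ → ∃ λ x → f x ≢ 0ℤ
∑≢0⇒∃≢0 []       f ∑≢0 = contradiction refl ∑≢0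
∑≢0⇒∃≢0 (x ∷ xs) f ∑≢0 with f x ℤ.≟ 0ℤ
... | no  fx≢0 = x , fx≢0
... | yes fx≡0 = ∑≢0⇒∃≢0 xs f λ ∑≡0 → ∑≢0 (cong₂ _+_ fx≡0 ∑≡0)

∑-nonNeg : ∀ xs (f : A → ℤ) → (∀ x → 0ℤ ≤ f x) → 0ℤ ≤ ∑ xs f
∑-nonNeg []       f f≥0 = +≤+ ℕ.z≤n
∑-nonNeg (x ∷ xs) f f≥0 = +-mono-≤ (f≥0 x) (∑-nonNeg xs f f≥0)

-- Nonnegative terms cannot cancel a positive one.
∑-pos : ∀ {xs} {f : A → ℤ} → (∀ x → 0ℤ ≤ f x) → ∀ {x} → x ∈ˡ xs → 0ℤ < f x → 0ℤ < ∑ xs f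
∑-pos {xs = _ ∷ xs} f≥0 (here refl) fx>0 = +-mono-<-≤ fx>0 (∑-nonNeg xs _ f≥0)
∑-pos {xs = y ∷ _}  f≥0 (there x∈)  fx>0 = +-mono-≤-< (f≥0 y) (∑-pos f≥0 x∈ fx>0)

∏-one : ∀ n → ∏ {n} (λ _ → 1ℤ) ≡ 1ℤ
∏-one zero    = refl
∏-one (suc n) = trans (*-identityˡ _) (∏-one n)

∏-zero : (f : Fin n → ℤ) (i : Fin n) → f i ≡ 0ℤ → ∏ f ≡ 0ℤ
∏-zero f zero    fi≡0 = cong (_* ∏ (f ∘ suc)) fi≡0
∏-zero f (suc i) fi≡0 = trans (cong (f zero *_) (∏-zero (f ∘ suc) i fi≡0)) (*-zeroʳ (f zero))

∏≢0⇒≢0 : (f : Fin n → ℤ) → ∏ f ≢ 0ℤ → ∀ i → f i ≢ 0ℤ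
∏≢0⇒≢0 f ∏≢0 i = ∏≢0 ∘ ∏-zero f i

∏≢0 : (f : Fin n → ℤ) → (∀ i → f i ≢ 0ℤ) → ∏ f ≢ 0ℤ
∏≢0 {zero}  f f≢0 = λ ()
∏≢0 {suc n} f f≢0 = [ f≢0 zero , ∏≢0 (f ∘ suc) (f≢0 ∘ suc) ] ∘ i*j≡0⇒i≡0∨j≡0 (f zero)

*-nonNeg : ∀ {i j} → 0ℤ ≤ i → 0ℤ ≤ j → 0ℤ ≤ i * j
*-nonNeg {+ k} {+ l} _ _ = subst (0ℤ ≤_) (pos-* k l) (+≤+ ℕ.z≤n)

∏-nonNeg : (f : Fin n → ℤ) → (∀ i → 0ℤ ≤ f i) → 0ℤ ≤ ∏ f
∏-nonNeg {zero}  f f≥0 = +≤+ ℕ.z≤n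
∏-nonNeg {suc n} f f≥0 = *-nonNeg (f≥0 zero) (∏-nonNeg (f ∘ suc) (f≥0 ∘ suc))

-- Sums over vectors, subsets and triples that factor over coordinates.

bits : List Bool
bits = outside ∷ inside ∷ []

-- The generalised distributive law: multiplying out the right side chooses one summand in each
-- factor, and these choices are the vectors.
∑-vecs-∏ : ∀ (xs : List A) n (f : Fin n → A → ℤ) →
  ∑ (vecs xs n) (λ v → ∏ λ i → f i (lookup v i)) ≡ ∏ λ i → ∑ xs (f i)
∑-vecs-∏ xs zero    f = refl
∑-vecs-∏ xs (suc n) f = begin
  ∑ (vecs xs (suc n)) (λ v → ∏ λ i → f i (lookup v i))
    ≡⟨ ∑-cartesianProductWith _∷_ xs (vecs xs n) (λ v → ∏ λ i → f i (lookup v i)) ⟩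
  ∑ xs (λ x → ∑ (vecs xs n) λ v → f zero x * ∏ λ i → f (suc i) (lookup v i))
    ≡⟨ ∑-cong (λ x → ∑-distribˡ-* (f zero x) (vecs xs n) _) xs ⟨
  ∑ xs (λ x → f zero x * ∑ (vecs xs n) λ v → ∏ λ i → f (suc i) (lookup v i))
    ≡⟨ ∑-cong (λ x → cong (f zero x *_) (∑-vecs-∏ xs n (f ∘ suc))) xs ⟩
  ∑ xs (λ x → f zero x * ∏ λ i → ∑ xs (f (suc i)))
    ≡⟨ ∑-distribʳ-* _ xs (f zero) ⟨
  ∑ xs (f zero) * ∏ (λ i → ∑ xs (f (suc i))) ∎

∈-vecs : ∀ {xs : List A} → (∀ x → x ∈ˡ xs) → (v : Vec A n) → v ∈ˡ vecs xs n
∈-vecs all∈ []      = here refl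
∈-vecs all∈ (x ∷ v) = ∈-cartesianProductWith⁺ _∷_ (all∈ x) (∈-vecs all∈ v)

∈-bits : ∀ b → b ∈ˡ bits
∈-bits false = here refl
∈-bits true  = there (here refl)

ι : Bool → ℤ
ι b = if b then 1ℤ else 0ℤ

σ : Bool → ℤ
σ b = if b then -1ℤ else 1ℤ

ι-∧ : ∀ x y → ι (x ∧ y) ≡ ι x * ι y
ι-∧ true  y = sym (*-identityˡ (ι y))
ι-∧ false y = refl

∑-filter : {P : Pred A p} (P? : Decidable P) → ∀ xs (f : A → ℤ) →
  ∑ (filter P? xs) f ≡ ∑ xs λ x → ι (does (P? x)) * f x
∑-filter P? []       f = refl
∑-filter P? (x ∷ xs) f with does (P? x)
... | true  = cong₂ _+_ (sym (*-identityˡ (f x))) (∑-filter P? xs f)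
... | false = trans (∑-filter P? xs f) (sym (+-identityˡ _))

-- If `Q` fails, decidability over a finite index set yields an index at which `P` fails, and its
-- factor 0 kills the product. This puts both inclusion of subsets and the Eulerian condition into
-- product form.
ι-∀ : {P : Pred (Fin n) p} (P? : Decidable P) {Q : Set q} (Q? : Dec Q) →
  (Q → ∀ i → P i) → ((∀ i → P i) → Q) → ι (does Q?) ≡ ∏ λ i → ι (does (P? i))
ι-∀ {n} P? (yes q) Q⇒∀P ∀P⇒Q = trans (sym (∏-one n))
  (∏-cong λ i → sym (cong ι (dec-true (P? i) (Q⇒∀P q i))))
ι-∀ {n} P? (no ¬q) Q⇒∀P ∀P⇒Q with i , ¬Pi ← ¬∀⟶∃¬ n _ P? (¬q ∘ ∀P⇒Q) =
  sym (∏-zero _ i (cong ι (dec-false (P? i) ¬Pi)))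

does-∈? : ∀ (i : Fin n) (S : Subset n) → does (i ∈? S) ≡ lookup S i
does-∈? zero    (true  ∷ S) = refl
does-∈? zero    (false ∷ S) = refl
does-∈? (suc i) (_ ∷ S)     = does-∈? i S

-- The membership bits that a subset of `X` may have at an element whose own membership in `X` is
-- the given bit.
below : Bool → List Bool
below false = outside ∷ []
below true  = bits

∑-below : ∀ x (f : Bool → ℤ) → ∑ bits (λ b → ι (not b ∨ x) * f b) ≡ ∑ (below x) f
∑-below false f = cong (λ u → u + 0ℤ) (*-identityˡ (f false))
∑-below true  f = cong₂ (λ u v → u + (v + 0ℤ)) (*-identityˡ (f false)) (*-identityˡ (f true))

-- Inclusion in `X` is a condition on each element separately, so its indicator is a product and can
-- be absorbed into the factors of the integrand. Then `∑-vecs-∏` applies, and the indicator removes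
-- the forbidden bits.
∑-subsetsOf-∏ : ∀ (X : Subset n) (f : Fin n → Bool → ℤ) →
  ∑ (subsetsOf X) (λ S → ∏ λ i → f i (lookup S i)) ≡ ∏ λ i → ∑ (below (lookup X i)) (f i)
∑-subsetsOf-∏ {n} X f = begin
  ∑ (subsetsOf X) (λ S → ∏ λ i → f i (lookup S i))
    ≡⟨ ∑-filter (_⊆? X) (vecs bits n) _ ⟩
  ∑ (vecs bits n) (λ S → ι (does (S ⊆? X)) * ∏ λ i → f i (lookup S i))
    ≡⟨ ∑-cong restrict (vecs bits n) ⟩
  ∑ (vecs bits n) (λ S → ∏ λ i → ι (not (lookup S i) ∨ lookup X i) * f i (lookup S i))
    ≡⟨ ∑-vecs-∏ bits n (λ i b → ι (not b ∨ lookup X i) * f i b) ⟩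
  ∏ (λ i → ∑ bits λ b → ι (not b ∨ lookup X i) * f i b)
    ≡⟨ ∏-cong (λ i → ∑-below (lookup X i) (f i)) ⟩
  ∏ (λ i → ∑ (below (lookup X i)) (f i)) ∎
  where
  restrict : ∀ S → ι (does (S ⊆? X)) * ∏ (λ i → f i (lookup S i))
                 ≡ ∏ λ i → ι (not (lookup S i) ∨ lookup X i) * f i (lookup S i)
  restrict S = begin
    ι (does (S ⊆? X)) * ∏ (λ i → f i (lookup S i))
      ≡⟨ cong (_* _) (ι-∀ (λ i → i ∈? S →-dec i ∈? X) (S ⊆? X) (λ S⊆X _ → S⊆X) (λ h → h _)) ⟩
    ∏ (λ i → ι (not (does (i ∈? S)) ∨ does (i ∈? X))) * ∏ (λ i → f i (lookup S i))
      ≡⟨ ∏-distrib-* (λ i → ι (not (does (i ∈? S)) ∨ does (i ∈? X))) (λ i → f i (lookup S i)) ⟨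
    ∏ (λ i → ι (not (does (i ∈? S)) ∨ does (i ∈? X)) * f i (lookup S i))
      ≡⟨ ∏-cong (λ i → cong₂ (λ u v → ι (not u ∨ v) * f i (lookup S i)) (does-∈? i S) (does-∈? i X)) ⟩
    ∏ (λ i → ι (not (lookup S i) ∨ lookup X i) * f i (lookup S i)) ∎

-- `∑-subsetsOf-∏` is applied three times from the inside out; each inner sum, once factored,
-- becomes part of the factor for the next one.
∑-triples-∏ : ∀ (X Y Z : Subset n) (f : Fin n → Bool → Bool → Bool → ℤ) →
  ∑ (triples X Y Z) (λ (A , B , C) → ∏ λ i → f i (lookup A i) (lookup B i) (lookup C i)) ≡
  ∏ λ i → ∑ (below (lookup X i)) λ a → ∑ (below (lookup Y i)) λ b → ∑ (below (lookup Z i)) (f i a b)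
∑-triples-∏ X Y Z f = begin
  ∑ (triples X Y Z) (λ (A , B , C) → ∏ λ i → f i (lookup A i) (lookup B i) (lookup C i))
    ≡⟨ ∑-cartesianProductWith _,_ (subsetsOf X) _ term ⟩
  ∑ (subsetsOf X) (λ A → ∑ (cartesianProduct (subsetsOf Y) (subsetsOf Z)) λ (B , C) →
    ∏ λ i → f i (lookup A i) (lookup B i) (lookup C i))
    ≡⟨ ∑-cong (λ A → ∑-cartesianProductWith _,_ (subsetsOf Y) (subsetsOf Z) (λ (B , C) → term (A , B , C))) (subsetsOf X) ⟩
  ∑ (subsetsOf X) (λ A → ∑ (subsetsOf Y) λ B → ∑ (subsetsOf Z) λ C →
    ∏ λ i → f i (lookup A i) (lookup B i) (lookup C i))
    ≡⟨ ∑-cong (λ A → ∑-cong (λ B → ∑-subsetsOf-∏ Z (λ i → f i (lookup A i) (lookup B i))) (subsetsOf Y)) (subsetsOf X) ⟩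
  ∑ (subsetsOf X) (λ A → ∑ (subsetsOf Y) λ B →
    ∏ λ i → ∑ (below (lookup Z i)) (f i (lookup A i) (lookup B i)))
    ≡⟨ ∑-cong (λ A → ∑-subsetsOf-∏ Y (λ i b → ∑ (below (lookup Z i)) (f i (lookup A i) b))) (subsetsOf X) ⟩
  ∑ (subsetsOf X) (λ A →
    ∏ λ i → ∑ (below (lookup Y i)) λ b → ∑ (below (lookup Z i)) (f i (lookup A i) b))
    ≡⟨ ∑-subsetsOf-∏ X (λ i a → ∑ (below (lookup Y i)) λ b → ∑ (below (lookup Z i)) (f i a b)) ⟩
  ∏ (λ i → ∑ (below (lookup X i)) λ a → ∑ (below (lookup Y i)) λ b → ∑ (below (lookup Z i)) (f i a b)) ∎
  where
  term : Triple _ → ℤ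
  term (A , B , C) = ∏ λ i → f i (lookup A i) (lookup B i) (lookup C i)

-- Parity expressed through signs.

-1^-parity : ∀ n → -1ℤ ^ n ≡ σ (not (does (2 ∣? n)))
-1^-parity zero          = refl
-1^-parity (suc zero)    = refl
-- Induction in steps of two: two factors -1 cancel, and adding 2 preserves divisibility by 2.
-1^-parity (suc (suc n)) = begin
  -1ℤ * (-1ℤ * -1ℤ ^ n)              ≡⟨ *-assoc -1ℤ -1ℤ (-1ℤ ^ n) ⟨
  1ℤ * -1ℤ ^ n                       ≡⟨ *-identityˡ _ ⟩
  -1ℤ ^ n                            ≡⟨ -1^-parity n ⟩
  σ (not (does (2 ∣? n)))            ≡⟨ cong (σ ∘ not) (does-⇔ 2∣n⇔2∣2+n (2 ∣? n) (2 ∣? suc (suc n))) ⟩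
  σ (not (does (2 ∣? suc (suc n))))  ∎
  where
  2∣n⇔2∣2+n = mk⇔ (∣m∣n⇒∣m+n ∣-refl) (λ d → ∣m+n∣m⇒∣n d ∣-refl)

-- The sum of both characters of the group of order two, evaluated at the parity of `n`. Each vertex
-- contributes one such factor 2, and together they make up `2^V`.
1+-1^ : ∀ n → 1ℤ + -1ℤ ^ n ≡ + 2 * ι (does (2 ∣? n))
1+-1^ n = trans (cong (_+_ 1ℤ) (-1^-parity n)) (lemma (does (2 ∣? n)))
  where
  lemma : ∀ b → 1ℤ + σ (not b) ≡ + 2 * ι b
  lemma true  = refl
  lemma false = refl

-1^-∣∣ : (S : Subset n) → -1ℤ ^ ∣ S ∣ ≡ ∏ λ i → σ (lookup S i)
-1^-∣∣ []          = refl
-1^-∣∣ (true  ∷ S) = cong (-1ℤ *_) (-1^-∣∣ S)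
-1^-∣∣ (false ∷ S) = trans (-1^-∣∣ S) (sym (*-identityˡ _))

-- Powers turn sums into products. An arbitrary `h` lets the induction pass to `h ∘ suc`; the case
-- needed is `allFin`, where `h` is the identity.
^-sum-filter-tabulate : ∀ y {P : Pred A p} (P? : Decidable P) (g : A → ℕ) (h : Fin n → A) →
  y ^ sum (map g (filter P? (List.tabulate h))) ≡ ∏ λ i → if does (P? (h i)) then y ^ g (h i) else 1ℤ
^-sum-filter-tabulate {n = zero}  y P? g h = refl
^-sum-filter-tabulate {n = suc n} y P? g h with does (P? (h zero))
... | true  = trans
  (^-distribˡ-+-* y (g (h zero)) (sum (map g (filter P? (List.tabulate (h ∘ suc))))))
  (cong (y ^ g (h zero) *_) (^-sum-filter-tabulate y P? g (h ∘ suc)))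
... | false = trans (^-sum-filter-tabulate y P? g (h ∘ suc)) (sym (*-identityˡ _))

∏-if : ∀ b (f : Fin n → ℤ) → (if b then ∏ f else 1ℤ) ≡ ∏ λ i → if b then f i else 1ℤ
∏-if     true  f = refl
∏-if {n} false f = sym (∏-one n)

-- Away from `v = u` the exponent is 0, so only the factor at `u` can differ from 1.
∏-point : (s : Vec Bool n) (u : Fin n) →
  ∏ (λ v → if lookup s v then -1ℤ ^ (if does (u Fin.≟ v) then 1 else 0) else 1ℤ) ≡ σ (lookup s u)
∏-point {suc n} (x ∷ s) zero = begin
  (if x then -1ℤ else 1ℤ) * ∏ (λ v → if lookup s v then 1ℤ else 1ℤ)
    ≡⟨ cong (σ x *_) (trans (∏-cong λ v → if-same (lookup s v)) (∏-one n)) ⟩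
  σ x * 1ℤ ≡⟨ *-identityʳ (σ x) ⟩
  σ x      ∎
  where
  if-same : ∀ b → (if b then 1ℤ else 1ℤ) ≡ 1ℤ
  if-same true  = refl
  if-same false = refl
-- Vertex `zero` is not `suc u`, so its factor is 1 for either value of its bit.
∏-point (true  ∷ s) (suc u) = trans (*-identityˡ _) (∏-point s u)
∏-point (false ∷ s) (suc u) = trans (*-identityˡ _) (∏-point s u)

σ-xor : ∀ x y → σ x * σ y ≡ σ (x xor y)
σ-xor true  true  = refl
σ-xor true  false = refl
σ-xor false true  = refl
σ-xor false false = refl

-- Fourier expansion of the Eulerian condition.

module _ (G : Graph) where

  private
    V = #V G
    E = #E G

  -- The coboundary of `s` over the field of two elements; it vanishes on every loop.
  cut : Vec Bool V → Fin E → Bool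
  cut s e = lookup s (proj₁ (ends G e)) xor lookup s (proj₂ (ends G e))

  -- Each end of `e` contributes the sign of `s` there. A loop contributes the same sign twice,
  -- hence 1, in agreement with its empty coboundary.
  ∏-incidence : ∀ (s : Vec Bool V) e →
    ∏ (λ v → if lookup s v then -1ℤ ^ incidence G v e else 1ℤ) ≡ σ (cut s e)
  ∏-incidence s e = begin
    ∏ (λ v → if lookup s v then -1ℤ ^ (δ u v ℕ.+ δ w v) else 1ℤ)
      ≡⟨ ∏-cong (λ v → split (lookup s v) (δ u v) (δ w v)) ⟩
    ∏ (λ v → at u v * at w v)
      ≡⟨ ∏-distrib-* (at u) (at w) ⟩
    ∏ (at u) * ∏ (at w)
      ≡⟨ cong₂ _*_ (∏-point s u) (∏-point s w) ⟩
    σ (lookup s u) * σ (lookup s w)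
      ≡⟨ σ-xor (lookup s u) (lookup s w) ⟩
    σ (cut s e) ∎
    where
    u = proj₁ (ends G e)
    w = proj₂ (ends G e)

    δ : Fin V → Fin V → ℕ
    δ x v = if does (x Fin.≟ v) then 1 else 0

    at : Fin V → Fin V → ℤ
    at x v = if lookup s v then -1ℤ ^ δ x v else 1ℤ

    split : ∀ b k l → (if b then -1ℤ ^ (k ℕ.+ l) else 1ℤ) ≡
                      (if b then -1ℤ ^ k else 1ℤ) * (if b then -1ℤ ^ l else 1ℤ)
    split true  k l = ^-distribˡ-+-* -1ℤ k l
    split false k l = refl

  -- Kept as a product over the vertices so that it merges factor by factor with the vertex
  -- conditions.
  2^V : ℤ
  2^V = ∏ {V} λ _ → + 2

  2^V≢0 : 2^V ≢ 0ℤ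
  2^V≢0 = ∏≢0 {V} _ λ _ ()

  -- Orthogonality of characters: a parity condition at every vertex is
  -- detected by averaging over all sign vectors s on the vertices.
  eulerian-fourier : ∀ S → 2^V * ι (does (eulerian? G S)) ≡
    ∑ (vecs bits V) λ s → ∏ λ e → if lookup S e then σ (cut s e) else 1ℤ
  eulerian-fourier S = begin
    2^V * ι (does (eulerian? G S))
      ≡⟨ cong (2^V *_) (ι-∀ (λ v → 2 ∣? degree G S v) (eulerian? G S) id id) ⟩
    2^V * ∏ (λ v → ι (does (2 ∣? degree G S v)))
      ≡⟨ ∏-distrib-* {V} (λ _ → + 2) (λ v → ι (does (2 ∣? degree G S v))) ⟨
    ∏ (λ v → + 2 * ι (does (2 ∣? degree G S v)))
      -- The extra identity law supplies the trailing 0 with which a sum over the list `bits` ends.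
      ≡⟨ ∏-cong (λ v → trans (sym (1+-1^ (degree G S v))) (cong (_+_ 1ℤ) (sym (+-identityʳ (-1ℤ ^ degree G S v))))) ⟩
    ∏ (λ v → ∑ bits λ b → if b then -1ℤ ^ degree G S v else 1ℤ)
      -- Multiplying out: the bit of `s` at `v` records which of the two characters was chosen at
      -- `v`.
      ≡⟨ ∑-vecs-∏ bits V (λ v b → if b then -1ℤ ^ degree G S v else 1ℤ) ⟨
    ∑ (vecs bits V) (λ s → ∏ λ v → if lookup s v then -1ℤ ^ degree G S v else 1ℤ)
      ≡⟨ ∑-cong byEdges (vecs bits V) ⟩
    ∑ (vecs bits V) (λ s → ∏ λ e → if lookup S e then σ (cut s e) else 1ℤ) ∎
    where
    if-swap : ∀ b c {x : ℤ} → (if b then (if c then x else 1ℤ) else 1ℤ) ≡ (if c then (if b then x else 1ℤ) else 1ℤ)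
    if-swap true  c     = refl
    if-swap false true  = refl
    if-swap false false = refl

    -1^-degree : ∀ v → -1ℤ ^ degree G S v ≡ ∏ λ e → if lookup S e then -1ℤ ^ incidence G v e else 1ℤ
    -1^-degree v = trans
      (^-sum-filter-tabulate -1ℤ (_∈? S) (incidence G v) id)
      (∏-cong λ e → cong (λ b → if b then -1ℤ ^ incidence G v e else 1ℤ) (does-∈? e S))

    byEdges : ∀ s → ∏ (λ v → if lookup s v then -1ℤ ^ degree G S v else 1ℤ) ≡
                    ∏ λ e → if lookup S e then σ (cut s e) else 1ℤ
    byEdges s = begin
      ∏ (λ v → if lookup s v then -1ℤ ^ degree G S v else 1ℤ)
        ≡⟨ ∏-cong (λ v → trans
             (cong (λ x → if lookup s v then x else 1ℤ) (-1^-degree v))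
             (∏-if (lookup s v) λ e → if lookup S e then -1ℤ ^ incidence G v e else 1ℤ)) ⟩
      ∏ (λ v → ∏ λ e → if lookup s v then (if lookup S e then -1ℤ ^ incidence G v e else 1ℤ) else 1ℤ)
        -- Double counting of incidences: the degrees are regrouped by edges, after which each edge
        -- of `S` sees only its two ends.
        ≡⟨ ∏-comm (λ v e → if lookup s v then (if lookup S e then -1ℤ ^ incidence G v e else 1ℤ) else 1ℤ) ⟩
      ∏ (λ e → ∏ λ v → if lookup s v then (if lookup S e then -1ℤ ^ incidence G v e else 1ℤ) else 1ℤ)
        ≡⟨ ∏-cong (λ e → trans
             (∏-cong λ v → if-swap (lookup s v) (lookup S e))
             (sym (∏-if (lookup S e) λ v → if lookup s v then -1ℤ ^ incidence G v e else 1ℤ))) ⟩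
      ∏ (λ e → if lookup S e then ∏ (λ v → if lookup s v then -1ℤ ^ incidence G v e else 1ℤ) else 1ℤ)
        ≡⟨ ∏-cong (λ e → cong (λ x → if lookup S e then x else 1ℤ) (∏-incidence s e)) ⟩
      ∏ (λ e → if lookup S e then σ (cut s e) else 1ℤ) ∎

-- The bias as a signed count.

+length-filter : {P : Pred A p} (P? : Decidable P) → ∀ xs →
  + length (filter P? xs) ≡ ∑ xs λ x → ι (does (P? x))
+length-filter P? []       = refl
+length-filter P? (x ∷ xs) with does (P? x)
... | true  = cong (_+_ 1ℤ) (+length-filter P? xs)
... | false = trans (+length-filter P? xs) (sym (+-identityˡ _))

signed-count : {S : Pred A p} {T : Pred A q} (S? : Decidable S) (T? : Decidable T) → ∀ xs →
  + length (filter (S? ∩? T?) xs) - + length (filter (∁? S? ∩? T?) xs) ≡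
  ∑ xs λ x → ι (does (T? x)) * σ (not (does (S? x)))
signed-count S? T? xs = begin
  + length (filter (S? ∩? T?) xs) - + length (filter (∁? S? ∩? T?) xs)
    ≡⟨ cong₂ _-_ (+length-filter (S? ∩? T?) xs) (+length-filter (∁? S? ∩? T?) xs) ⟩
  ∑ xs even - ∑ xs odd
    ≡⟨ cong (_+_ (∑ xs even)) (trans (sym (-1*i≡-i (∑ xs odd))) (∑-distribˡ-* -1ℤ xs odd)) ⟩
  ∑ xs even + ∑ xs (λ x → -1ℤ * odd x)
    ≡⟨ ∑-distrib-+ xs even (λ x → -1ℤ * odd x) ⟨
  ∑ xs (λ x → even x + -1ℤ * odd x)
    ≡⟨ ∑-cong (λ x → cases (does (S? x)) (does (T? x))) xs ⟩
  ∑ xs (λ x → ι (does (T? x)) * σ (not (does (S? x)))) ∎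
  where
  even = λ x → ι (does (S? x) ∧ does (T? x))
  odd  = λ x → ι (not (does (S? x)) ∧ does (T? x))

  cases : ∀ b c → ι (b ∧ c) + -1ℤ * ι (not b ∧ c) ≡ ι c * σ (not b)
  cases true  true  = refl
  cases true  false = refl
  cases false true  = refl
  cases false false = refl

÷-injective : ∀ {x y} r .{{_ : ℚ.NonZero r}} → x ℚ.÷ r ≡ y ℚ.÷ r → x ≡ y
÷-injective {x} {y} r eq = trans (sym (cancel x)) (trans (cong (ℚ._* r) eq) (cancel y))
  where
  cancel : ∀ z → (z ℚ.÷ r) ℚ.* r ≡ z
  cancel z = trans (ℚ.*-assoc z (ℚ.1/ r) r) (trans (cong (ℚ._*_ z) (ℚ.*-inverseˡ r)) (ℚ.*-identityʳ z))

/-injective : ∀ k l d .{{_ : NonZero d}} → + k ℚ./ d ≡ + l ℚ./ d → k ≡ l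
/-injective k l (suc d) eq with *≡* eq′ ← ℚ./-injective-≃ (mkℚᵘ (+ k) d) (mkℚᵘ (+ l) d) eq =
  +-injective (*-cancelʳ-≡ (+ k) (+ l) (+ suc d) eq′)

module _ (Ω : List A) .{{_ : NonZero (length Ω)}}
         {S : Pred A p} {T : Pred A q} (S? : Decidable S) (T? : Decidable T)
         .{{_ : ℚ.NonZero (ℙ Ω T?)}} where

  private
    signed : ℤ
    signed = ∑ Ω λ x → ι (does (T? x)) * σ (not (does (S? x)))

    k l : ℕ
    k = length (filter (S? ∩? T?) Ω)
    l = length (filter (∁? S? ∩? T?) Ω)

  -- Both conditional probabilities are counts divided by the same nonzero quantities, so the bias
  -- vanishes exactly when the two counts `k` and `l` agree, and `signed` is their difference.
  Bias≡0⇔signed≡0 : Bias[_∣_] Ω S? T? ≡ 0ℚ ⇔ signed ≡ 0ℤ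
  Bias≡0⇔signed≡0 = mk⇔ to from
    where
    to : Bias[_∣_] Ω S? T? ≡ 0ℚ → signed ≡ 0ℤ
    to bias≡0 = trans (sym (signed-count S? T? Ω)) (i≡j⇒i-j≡0 (cong +_
      (/-injective k l (length Ω) (÷-injective {x = + k ℚ./ length Ω} {y = + l ℚ./ length Ω} (ℙ Ω T?)
        (x∙y⁻¹≈ε⇒x≈y ℚ.+-0-group (ℙ[_∣_] Ω S? T?) (ℙ[_∣_] Ω (∁? S?) T?) bias≡0)))))

    from : signed ≡ 0ℤ → Bias[_∣_] Ω S? T? ≡ 0ℚ
    from signed≡0 = trans
      -- Replacing the count `k` by `l` turns the first conditional probability into the second,
      -- which leaves a number minus itself.
      (cong (λ i → (i ℚ./ length Ω ℚ.÷ ℙ Ω T?) ℚ.- ℙ[_∣_] Ω (∁? S?) T?) {+ k} {+ l}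
        (i-j≡0⇒i≡j (+ k) (+ l) (trans (signed-count S? T? Ω) signed≡0)))
      (ℚ.+-inverseʳ (ℙ[_∣_] Ω (∁? S?) T?))

-- The contribution of a single edge.

edgeTerm : (p q a b c : Bool) → ℤ
edgeTerm p q a b c =
  ((if a ∨ c then σ p else 1ℤ) * (if c ∨ b then σ q else 1ℤ)) * (σ a * (σ b * σ c))

-- An edge of X must be cut by s, an edge of Y by t, and an edge of Z by
-- exactly one of s and t.
separated : (x y z p q : Bool) → Bool
separated x y z p q = (x ∧ p) ∨ (y ∧ q) ∨ (z ∧ (p xor q))

-- The hypotheses make exactly one of `x`, `y`, `z` true, so one membership bit is free. Leaving the
-- edge out gives 1; taking it gives minus the character of each union that contains it. An edge of
-- `Z` enters both unions, which is why `p` and `q` combine there.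
∑-edgeTerm : ∀ x y z p q → x ∨ y ∨ z ≡ true → x ∧ y ≡ false → x ∧ z ≡ false → y ∧ z ≡ false →
  ∑ (below x) (λ a → ∑ (below y) λ b → ∑ (below z) (edgeTerm p q a b)) ≡
  + (if separated x y z p q then 2 else 0)
∑-edgeTerm true  false false true  true  _ _ _ _ = refl
∑-edgeTerm true  false false true  false _ _ _ _ = refl
∑-edgeTerm true  false false false true  _ _ _ _ = refl
∑-edgeTerm true  false false false false _ _ _ _ = refl
∑-edgeTerm false true  false true  true  _ _ _ _ = refl
∑-edgeTerm false true  false true  false _ _ _ _ = refl
∑-edgeTerm false true  false false true  _ _ _ _ = refl
∑-edgeTerm false true  false false false _ _ _ _ = refl
∑-edgeTerm false false true  true  true  _ _ _ _ = refl
∑-edgeTerm false false true  true  false _ _ _ _ = refl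
∑-edgeTerm false false true  false true  _ _ _ _ = refl
∑-edgeTerm false false true  false false _ _ _ _ = refl

-- The Fourier identity for a tripartition and its consequences.

module _ (G : Graph) (X Y Z : Subset (#E G)) where

  edgeSeparated : Vec Bool (#V G) × Vec Bool (#V G) → Fin (#E G) → Bool
  edgeSeparated (s , t) e = separated (lookup X e) (lookup Y e) (lookup Z e) (cut G s e) (cut G t e)

module _ (G : Graph) (X Y Z : Subset (#E G)) (XYZ : IsTripartition X Y Z) where

  open IsTripartition XYZ

  private
    V = #V G
    E = #E G

    Ω : List (Triple E)
    Ω = triples X Y Z

    pairs : List (Vec Bool V × Vec Bool V)
    pairs = cartesianProduct (vecs bits V) (vecs bits V)

    signed : Triple E → ℤ
    signed t = ι (does (bothEulerian? G t)) * σ (not (does (evenTotal? t)))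

    summand : Vec Bool V × Vec Bool V → Triple E → ℤ
    summand (s , t) (A , B , C) =
      ∏ λ e → edgeTerm (cut G s e) (cut G t e) (lookup A e) (lookup B e) (lookup C e)

  weight : Vec Bool V × Vec Bool V → ℤ
  weight st = ∏ λ e → + (if edgeSeparated G X Y Z st e then 2 else 0)

  private
    sign-∏ : ∀ (t@(A , B , C) : Triple E) → σ (not (does (evenTotal? t))) ≡
      ∏ λ e → σ (lookup A e) * (σ (lookup B e) * σ (lookup C e))
    sign-∏ (A , B , C) = begin
      σ (not (does (2 ∣? ∣ A ∣ ℕ.+ ∣ B ∣ ℕ.+ ∣ C ∣)))
        ≡⟨ -1^-parity (∣ A ∣ ℕ.+ ∣ B ∣ ℕ.+ ∣ C ∣) ⟨
      -1ℤ ^ (∣ A ∣ ℕ.+ ∣ B ∣ ℕ.+ ∣ C ∣)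
        ≡⟨ ^-distribˡ-+-* -1ℤ (∣ A ∣ ℕ.+ ∣ B ∣) ∣ C ∣ ⟩
      -1ℤ ^ (∣ A ∣ ℕ.+ ∣ B ∣) * -1ℤ ^ ∣ C ∣
        ≡⟨ cong (_* -1ℤ ^ ∣ C ∣) (^-distribˡ-+-* -1ℤ ∣ A ∣ ∣ B ∣) ⟩
      -1ℤ ^ ∣ A ∣ * -1ℤ ^ ∣ B ∣ * -1ℤ ^ ∣ C ∣
        ≡⟨ *-assoc (-1ℤ ^ ∣ A ∣) (-1ℤ ^ ∣ B ∣) (-1ℤ ^ ∣ C ∣) ⟩
      -1ℤ ^ ∣ A ∣ * (-1ℤ ^ ∣ B ∣ * -1ℤ ^ ∣ C ∣)
        ≡⟨ cong₂ _*_ (-1^-∣∣ A) (cong₂ _*_ (-1^-∣∣ B) (-1^-∣∣ C)) ⟩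
      ∏ (σ ∘ lookup A) * (∏ (σ ∘ lookup B) * ∏ (σ ∘ lookup C))
        ≡⟨ cong (_*_ (∏ (σ ∘ lookup A))) (∏-distrib-* (σ ∘ lookup B) (σ ∘ lookup C)) ⟨
      ∏ (σ ∘ lookup A) * ∏ (λ e → σ (lookup B e) * σ (lookup C e))
        ≡⟨ ∏-distrib-* (σ ∘ lookup A) (λ e → σ (lookup B e) * σ (lookup C e)) ⟨
      ∏ (λ e → σ (lookup A e) * (σ (lookup B e) * σ (lookup C e))) ∎

    -- The vector `s` tests `A ∪ C` and `t` tests `C ∪ B`; one factor `2^V G` is spent on each test.
    -- All remaining signs are products over the edges and merge into one product.
    signed-fourier : ∀ t → (2^V G * 2^V G) * signed t ≡ ∑ pairs λ st → summand st t
    signed-fourier t@(A , B , C) = begin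
      (K * K) * (ι (does (eulerian? G (A ∪ C)) ∧ does (eulerian? G (C ∪ B))) * z)
        ≡⟨ cong (λ w → (K * K) * (w * z)) (ι-∧ (does (eulerian? G (A ∪ C))) (does (eulerian? G (C ∪ B)))) ⟩
      (K * K) * (x * y * z)
        ≡⟨ *-assoc (K * K) (x * y) z ⟨
      ((K * K) * (x * y)) * z
        -- Each copy of `K` moves next to one of the two indicators, the form in which
        -- `eulerian-fourier` applies.
        ≡⟨ cong (_* z) (interchange *-commutativeSemigroup K K x y) ⟩
      ((K * x) * (K * y)) * z
        ≡⟨ cong (_* z) (cong₂ _*_ (eulerian-fourier G (A ∪ C)) (eulerian-fourier G (C ∪ B))) ⟩
      (∑ (vecs bits V) (χ (A ∪ C)) * ∑ (vecs bits V) (χ (C ∪ B))) * z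
        ≡⟨ cong (_* z) (∑-*-∑ (vecs bits V) (vecs bits V) (χ (A ∪ C)) (χ (C ∪ B))) ⟩
      ∑ pairs (λ (s , t) → χ (A ∪ C) s * χ (C ∪ B) t) * z
        ≡⟨ ∑-distribʳ-* z pairs (λ (s , t) → χ (A ∪ C) s * χ (C ∪ B) t) ⟩
      ∑ pairs (λ (s , t) → χ (A ∪ C) s * χ (C ∪ B) t * z)
        ≡⟨ ∑-cong merge pairs ⟩
      ∑ pairs (λ st → summand st t) ∎
      where
      K = 2^V G
      x = ι (does (eulerian? G (A ∪ C)))
      y = ι (does (eulerian? G (C ∪ B)))
      z = σ (not (does (evenTotal? t)))

      χᵉ : Subset E → Vec Bool V → Fin E → ℤ
      χᵉ S s e = if lookup S e then σ (cut G s e) else 1ℤ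

      χ : Subset E → Vec Bool V → ℤ
      χ S s = ∏ (χᵉ S s)

      sign : Fin E → ℤ
      sign e = σ (lookup A e) * (σ (lookup B e) * σ (lookup C e))

      merge : ∀ (st@(s , t) : Vec Bool V × Vec Bool V) → χ (A ∪ C) s * χ (C ∪ B) t * z ≡ summand st (A , B , C)
      merge (s , t) = begin
        χ (A ∪ C) s * χ (C ∪ B) t * z
          ≡⟨ cong₂ _*_ (sym (∏-distrib-* (χᵉ (A ∪ C) s) (χᵉ (C ∪ B) t))) (sign-∏ (A , B , C)) ⟩
        ∏ (λ e → χᵉ (A ∪ C) s e * χᵉ (C ∪ B) t e) * ∏ sign
          ≡⟨ ∏-distrib-* (λ e → χᵉ (A ∪ C) s e * χᵉ (C ∪ B) t e) sign ⟨
        ∏ (λ e → χᵉ (A ∪ C) s e * χᵉ (C ∪ B) t e * sign e)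
          ≡⟨ ∏-cong (λ e → cong₂ (λ u v → (if u then σ (cut G s e) else 1ℤ) * (if v then σ (cut G t e) else 1ℤ) * sign e)
               (lookup-zipWith _∨_ e A C) (lookup-zipWith _∨_ e C B)) ⟩
        summand (s , t) (A , B , C) ∎

    lookup-⊥ : ∀ (S T : Subset E) e → S ∩ T ≡ ⊥ → lookup S e ∧ lookup T e ≡ false
    lookup-⊥ S T e S∩T≡⊥ = trans (sym (lookup-zipWith _∧_ e S T))
      (trans (cong (λ U → lookup U e) S∩T≡⊥) (lookup-replicate e outside))

    -- For a fixed pair, membership in `A`, `B` and `C` is chosen independently at each edge, so the
    -- sum over triples factors into single-edge sums.
    ∑-summand : ∀ st → ∑ Ω (summand st) ≡ weight st
    ∑-summand (s , t) = trans
      (∑-triples-∏ X Y Z (λ e → edgeTerm (cut G s e) (cut G t e)))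
      (∏-cong λ e → ∑-edgeTerm (lookup X e) (lookup Y e) (lookup Z e) (cut G s e) (cut G t e)
        (covered e) (lookup-⊥ X Y e X∩Y≡⊥) (lookup-⊥ X Z e X∩Z≡⊥) (lookup-⊥ Y Z e Y∩Z≡⊥))
      where
      covered : ∀ e → lookup X e ∨ lookup Y e ∨ lookup Z e ≡ true
      covered e = begin
        lookup X e ∨ lookup Y e ∨ lookup Z e ≡⟨ cong (lookup X e ∨_) (lookup-zipWith _∨_ e Y Z) ⟨
        lookup X e ∨ lookup (Y ∪ Z) e        ≡⟨ lookup-zipWith _∨_ e X (Y ∪ Z) ⟨
        lookup (X ∪ Y ∪ Z) e                 ≡⟨ cong (λ U → lookup U e) X∪Y∪Z≡⊤ ⟩
        lookup ⊤ e                           ≡⟨ lookup-replicate e inside ⟩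
        true                                 ∎

    -- With the pair outermost, the inner sum over triples can be evaluated edge by edge.
    fourier : (2^V G * 2^V G) * ∑ Ω signed ≡ ∑ pairs weight
    fourier = begin
      (2^V G * 2^V G) * ∑ Ω signed                    ≡⟨ ∑-distribˡ-* (2^V G * 2^V G) Ω signed ⟩
      ∑ Ω (λ t → (2^V G * 2^V G) * signed t)          ≡⟨ ∑-cong signed-fourier Ω ⟩
      ∑ Ω (λ t → ∑ pairs λ st → summand st t)         ≡⟨ ∑-comm Ω pairs (λ t st → summand st t) ⟩
      ∑ pairs (λ st → ∑ Ω (summand st))               ≡⟨ ∑-cong ∑-summand pairs ⟩
      ∑ pairs weight                                  ∎

    bias⇔ : bias G X Y Z ≡ 0ℚ ⇔ ∑ Ω signed ≡ 0ℤ
    bias⇔ = Bias≡0⇔signed≡0 Ω {{triples-nonZero X Y Z}} evenTotal? (bothEulerian? G)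
      {{ℙ-bothEulerian-nonZero G X Y Z}}

  -- A nonzero sum has a nonzero term, and a nonzero product has no zero factor.
  bias≢0⇒separated : bias G X Y Z ≢ 0ℚ → ∃ λ st → ∀ e → edgeSeparated G X Y Z st e ≡ true
  bias≢0⇒separated bias≢0 =
    let st , w≢0 = ∑≢0⇒∃≢0 pairs weight ∑≢0
    in  st , λ e → true? (edgeSeparated G X Y Z st e)
                     (∏≢0⇒≢0 (λ e → + (if edgeSeparated G X Y Z st e then 2 else 0)) w≢0 e)
    where
    true? : ∀ b → + (if b then 2 else 0) ≢ 0ℤ → b ≡ true
    true? true  _  = refl
    true? false ≢0 = contradiction refl ≢0

    K²≢0 : 2^V G * 2^V G ≢ 0ℤ
    K²≢0 = [ 2^V≢0 G , 2^V≢0 G ] ∘ i*j≡0⇒i≡0∨j≡0 (2^V G)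

    ∑≢0 : ∑ pairs weight ≢ 0ℤ
    ∑≢0 ∑≡0 = [ K²≢0 , bias≢0 ∘ Equivalence.from bias⇔ ] (i*j≡0⇒i≡0∨j≡0 (2^V G * 2^V G) (trans fourier ∑≡0))

  -- No weight is negative, so the positive weight of the given pair survives in the sum over all
  -- pairs.
  separated⇒bias≢0 : ∀ st → (∀ e → edgeSeparated G X Y Z st e ≡ true) → bias G X Y Z ≢ 0ℚ
  separated⇒bias≢0 st@(s , t) separated≡true bias≡0 = <-irrefl (sym ∑≡0)
    (∑-pos weight≥0 (∈-cartesianProduct⁺ (∈-vecs ∈-bits s) (∈-vecs ∈-bits t)) weight>0)
    where
    weight≥0 : ∀ st → 0ℤ ≤ weight st
    weight≥0 st = ∏-nonNeg (λ e → + (if edgeSeparated G X Y Z st e then 2 else 0)) (λ _ → +≤+ ℕ.z≤n)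

    weight>0 : 0ℤ < weight st
    weight>0 = ≤∧≢⇒< (weight≥0 st)
      (∏≢0 _ (λ e → subst (λ b → + (if b then 2 else 0) ≢ 0ℤ) (sym (separated≡true e)) λ ()) ∘ sym)

    ∑≡0 : ∑ pairs weight ≡ 0ℤ
    ∑≡0 = trans (sym fourier)
      (trans (cong (_*_ (2^V G * 2^V G)) (Equivalence.to bias⇔ bias≡0)) (*-zeroʳ (2^V G * 2^V G)))

-- Four colours as pairs of bits.

pack : Bool → Bool → Fin 4
pack false false = 0F
pack false true  = 1F
pack true  false = 2F
pack true  true  = 3F

unpack : Fin 4 → Bool × Bool
unpack 0F = false , false
unpack 1F = false , true
unpack 2F = true  , false
unpack 3F = true  , true

unpack-pack : ∀ x y → unpack (pack x y) ≡ (x , y)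
unpack-pack false false = refl
unpack-pack false true  = refl
unpack-pack true  false = refl
unpack-pack true  true  = refl

pack-unpack : ∀ c → uncurry pack (unpack c) ≡ c
pack-unpack 0F = refl
pack-unpack 1F = refl
pack-unpack 2F = refl
pack-unpack 3F = refl

xor-false⇒≡ : ∀ x y → x xor y ≡ false → x ≡ y
xor-false⇒≡ true  true  _ = refl
xor-false⇒≡ false false _ = refl

P≢0⇔colourable : ∀ G q → P G q ≢ 0 ⇔ ∃ (Proper G {q})
P≢0⇔colourable G q = mk⇔ to from
  where
  colourings = vecs (allFin q) (#V G)

  head : ∀ (κs : List (Vec (Fin q) (#V G))) → length κs ≢ 0 → ∃ (_∈ˡ κs)
  head []       ≢0 = contradiction refl ≢0
  head (κ ∷ κs) _  = κ , here refl

  to : P G q ≢ 0 → ∃ (Proper G)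
  to P≢0 = let κ , κ∈ = head (filter (proper? G) colourings) P≢0
           in  κ , proj₂ (∈-filter⁻ (proper? G) {xs = colourings} κ∈)

  from : ∃ (Proper G) → P G q ≢ 0
  from (κ , proper) P≡0 = ℕ.<-irrefl (sym P≡0)
    (∈-length (∈-filter⁺ (proper? G) (∈-vecs ∈-allFin κ) proper))

module _ (G : Graph) where

  -- The bits of `s` and `t` at a vertex form its colour. If the ends of an edge had equal colours,
  -- neither vector would cut the edge, and it would fail to be separated in whichever block it
  -- lies.
  separated⇒colourable : ∀ X Y Z st → (∀ e → edgeSeparated G X Y Z st e ≡ true) → ∃ (Proper G {4})
  separated⇒colourable X Y Z (s , t) separated≡true = tabulate colour , proper
    where
    colour : Fin (#V G) → Fin 4
    colour v = pack (lookup s v) (lookup t v)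

    uncut : ∀ x y z → separated x y z false false ≡ false
    uncut true  true  true  = refl
    uncut true  true  false = refl
    uncut true  false true  = refl
    uncut true  false false = refl
    uncut false true  true  = refl
    uncut false true  false = refl
    uncut false false true  = refl
    uncut false false false = refl

    proper : Proper G (tabulate colour)
    proper e eq = contradiction (trans (sym (separated≡true e))
        (trans (cong₂ (separated (lookup X e) (lookup Y e) (lookup Z e))
                 (same s (cong proj₁ bits≡)) (same t (cong proj₂ bits≡)))
               (uncut (lookup X e) (lookup Y e) (lookup Z e)))) λ ()
      where
      u = proj₁ (ends G e)
      w = proj₂ (ends G e)

      bits≡ : (lookup s u , lookup t u) ≡ (lookup s w , lookup t w)
      bits≡ = begin
        (lookup s u , lookup t u)                ≡⟨ unpack-pack _ _ ⟨
        unpack (colour u)                        ≡⟨ cong unpack (lookup∘tabulate colour u) ⟨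
        unpack (lookup (tabulate colour) u)      ≡⟨ cong unpack eq ⟩
        unpack (lookup (tabulate colour) w)      ≡⟨ cong unpack (lookup∘tabulate colour w) ⟩
        unpack (colour w)                        ≡⟨ unpack-pack _ _ ⟩
        (lookup s w , lookup t w)                ∎

      same : ∀ r → lookup r u ≡ lookup r w → cut G r e ≡ false
      same r eq = trans (cong (_xor lookup r w) eq) (xor-same (lookup r w))

  -- The first bit of the colour defines `s` and the second defines `t`. Edges cut by `s` form `X`;
  -- on all others the first bits agree, so properness forces `t` to cut them, as membership in
  -- `∁ X` requires.
  colourable⇒bias≢0 : ∃ (Proper G {4}) →
    ∃[ X ] ∃[ Y ] ∃[ Z ] (IsTripartition {#E G} X Y Z × bias G X Y Z ≢ 0ℚ)
  colourable⇒bias≢0 (κ , proper) = X , ∁ X , ⊥ , tripartition ,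
    separated⇒bias≢0 G X (∁ X) ⊥ tripartition (s , t) λ e →
      -- The membership bits of `e` in the three blocks become `cut G s e`, its negation and
      -- `false`, the arguments in `separated-cut`.
      trans (cong₂ (λ (x , y) z → separated x y z (cut G s e) (cut G t e))
               (cong₂ _,_ (lookup-X e) (trans (lookup-map e not X) (cong not (lookup-X e))))
               (lookup-replicate e outside))
            (separated-cut (cut G s e) (cut G t e) (cuts≢false e))
    where
    s t : Vec Bool (#V G)
    s = Vec.map (proj₁ ∘ unpack) κ
    t = Vec.map (proj₂ ∘ unpack) κ

    X : Subset (#E G)
    X = tabulate (cut G s)

    lookup-X : ∀ e → lookup X e ≡ cut G s e
    lookup-X = lookup∘tabulate (cut G s)

    tripartition : IsTripartition X (∁ X) ⊥
    tripartition = record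
      { X∪Y∪Z≡⊤ = trans (cong (X ∪_) (∪-identityʳ (∁ X))) (∪-inverseʳ X)
      ; X∩Y≡⊥   = ∩-inverseʳ X
      ; X∩Z≡⊥   = ∩-zeroʳ X
      ; Y∩Z≡⊥   = ∩-zeroʳ (∁ X)
      }

    separated-cut : ∀ p q → ¬ (p ≡ false × q ≡ false) → separated p (not p) false p q ≡ true
    separated-cut true  _     _      = refl
    separated-cut false true  _      = refl
    separated-cut false false ≢false = contradiction (refl , refl) ≢false

    -- An edge cut by neither vector has equal first bits and equal second bits at its ends, hence
    -- equal colours.
    cuts≢false : ∀ e → ¬ (cut G s e ≡ false × cut G t e ≡ false)
    cuts≢false e (s≡ , t≡) = proper e (begin
      lookup κ u                          ≡⟨ pack-unpack _ ⟨
      uncurry pack (unpack (lookup κ u))  ≡⟨ cong₂ pack (same proj₁ s≡) (same proj₂ t≡) ⟩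
      uncurry pack (unpack (lookup κ w))  ≡⟨ pack-unpack _ ⟩
      lookup κ w                          ∎)
      where
      u = proj₁ (ends G e)
      w = proj₂ (ends G e)

      same : ∀ (f : Bool × Bool → Bool) → cut G (Vec.map (f ∘ unpack) κ) e ≡ false →
        f (unpack (lookup κ u)) ≡ f (unpack (lookup κ w))
      same f eq = begin
        f (unpack (lookup κ u))        ≡⟨ lookup-map u (f ∘ unpack) κ ⟨
        lookup (Vec.map (f ∘ unpack) κ) u  ≡⟨ xor-false⇒≡ _ _ eq ⟩
        lookup (Vec.map (f ∘ unpack) κ) w  ≡⟨ lookup-map w (f ∘ unpack) κ ⟩
        f (unpack (lookup κ w))        ∎

theorem3p5 : (G : Graph) →
    (∃[ X ] ∃[ Y ] ∃[ Z ]
    (IsTripartition {#E G} X Y Z × bias G X Y Z ≢ 0ℚ))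
    ⇔ (P G 4 ≢ 0)
theorem3p5 G = mk⇔
  (λ (X , Y , Z , XYZ , bias≢0) → Equivalence.from (P≢0⇔colourable G 4)
    (uncurry (separated⇒colourable G X Y Z) (bias≢0⇒separated G X Y Z XYZ bias≢0)))
  (colourable⇒bias≢0 G ∘ Equivalence.to (P≢0⇔colourable G 4))
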